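{- The class of timed languages recognizable by nondeterministic timed automata (with any finite number of clocks) and the class of timed languages recognizable by one-clock alternating timed automata are incomparable: neither class is contained in the other.
   Context: Languages are sets of finite timed words. Let $\mathbb{R}_+$ be the set of nonnegative reals. For a finite set $\mathcal{C}$ of clocks, the set $\Phi(\mathcal{C})$ of clock constraints is given by $\sigma ::= x<c \mid x\le c \mid \sigma_1\wedge\sigma_2\mid \neg\sigma$, with $x\in\mathcal{C}$ and $c$ a nonnegative integer constant; $[\sigma]\subseteq(\mathbb{R}_+)^{\mathcal{C}}$ is the set of valuations satisfying $\sigma$. $\mathcal{B}^+(X)$ is the set of positive boolean formulas over $X$: $\phi::= x\in X\mid \phi_1\wedge\phi_2\mid\phi_1\vee\phi_2$. $\mathcal{P}$ denotes power set. A timed word over a finite alphabet $\Sigma$ is a finite sequence $w=(a_1,t_1)\cdots(a_n,t_n)$ in $\Sigma\times\mathbb{R}_+$, where $t_i$ is the time elapsed between reading $a_{i-1}$ and $a_i$ ($t_1$: since time $0$). A nondeterministic timed automaton has a finite set $Q$ of locations, an initial $q_0\in Q$, accepting set $F\subseteq Q$, finite clock set $\mathcal{C}$ and a finite set of rules $\langle q,a,\sigma,q',r\rangle\in Q\times\Sigma\times\Phi(\mathcal{C})\times Q\times\mathcal{P}(\mathcal{C})$: in location $q$, reading $a$ when the current clock valuation (after the time delay) satisfies $\sigma$, it may move to $q'$ resetting the clocks in $r$ to $0$. It starts in $q_0$ with all clocks $0$ and accepts $w$ iff some run on all of $w$ ends in $F$. An alternating timed automaton is a tuple $\mathcal{A}=(Q,q_0,\Sigma,\mathcal{C},F,\delta)$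 with $Q$ a finite set of locations, $q_0\in Q$, $\mathcal{C}$ a finite set of clocks, $F\subseteq Q$, and $\delta: Q\times\Sigma\times\Phi(\mathcal{C})\rightharpoonup \mathcal{B}^+(Q\times\mathcal{P}(\mathcal{C}))$ a finite partial function satisfying (Partition): for all $q,a$, the sets $[\sigma]$ with $\delta(q,a,\sigma)$ defined form a finite partition of $(\mathbb{R}_+)^{\mathcal{C}}$ (so each valuation satisfies exactly one such $\sigma$). The acceptance game of $\mathcal{A}$ on $w$ is played by Adam and Eve, starting at $(q_0,\mathbf{v}_0)$ with $\mathbf{v}_0$ all-zero. In phase $k+1$ ($0\le k<n$), from $(q_k,\mathbf{v}_k)$, let $\bar{\mathbf{v}}=\mathbf{v}_k+t_{k+1}$ (every clock increased by $t_{k+1}$), let $\sigma$ be the unique constraint satisfied by $\bar{\mathbf{v}}$ with $b=\delta(q_k,a_{k+1},\sigma)$ defined. While $b=b_1\wedge b_2$, Adam chooses a conjunct to replace $b$; while $b=b_1\vee b_2$, Eve chooses a disjunct; when $b=(q,r)$, the phase ends with $(q_{k+1},\mathbf{v}_{k+1})=(q,\bar{\mathbf{v}}[r:=0])$ (clocks in $r$ reset to $0$). Eve wins iff $q_n\in F$. $\mathcal{A}$ accepts $w$ iff Eve has a winning strategy. One-clock means $|\mathcal{C}|=1$. -}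

module Defs where

open import Data.Bool.Base using (if_then_else_)
open import Data.Fin.Base using (Fin)
open import Data.Fin.Subset using (Subset; _∈_)
open import Data.Fin.Subset.Properties using (_∈?_)
import Data.Integer.Base as ℤ
open import Data.List.Base using (List; []; _∷_)
import Data.List.Membership.Propositional as List
open import Data.Maybe.Base using (Maybe; just)
open import Data.Nat.Base as ℕ using (ℕ; _⊔_)
import Data.Nat.Properties as ℕₚ
open import Data.Product.Base using (Σ-syntax; ∃-syntax; _×_; _,_)
open import Data.Rational.Base as ℚ using (ℚ; 0ℚ; ½; ∣_∣)
import Data.Rational.Properties as ℚₚ
open import Level using (0ℓ)
open import Relation.Binary.PropositionalEquality
  using (_≡_; sym; trans; cong; subst; subst₂)
open import Relation.Nullary using (¬_; does)
open import Relation.Unary using (Pred; _≐_)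

-- Real numbers: Cauchy sequences of rationals.  Two sequences represent
-- the same real when each is ≤ᵣ the other; the automata below inspect
-- reals only through _<ᵣ_ and _≤ᵣ_, which respect this equality.

IsCauchy : (ℕ → ℚ) → Set
IsCauchy s = ∀ ε → 0ℚ ℚ.< ε →
  ∃[ N ] (∀ m n → N ℕ.≤ m → N ℕ.≤ n → ∣ s m ℚ.- s n ∣ ℚ.< ε)

record ℝ : Set where
  constructor mkℝ
  field
    seq    : ℕ → ℚ
    cauchy : IsCauchy seq

open ℝ public

infix 4 _<ᵣ_ _≤ᵣ_

_<ᵣ_ : ℝ → ℝ → Set
x <ᵣ y = ∃[ ε ] (0ℚ ℚ.< ε ×
  (∃[ N ] (∀ n → N ℕ.≤ n → seq x n ℚ.+ ε ℚ.≤ seq y n)))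

_≤ᵣ_ : ℝ → ℝ → Set
x ≤ᵣ y = ∀ ε → 0ℚ ℚ.< ε →
  ∃[ N ] (∀ n → N ℕ.≤ n → seq x n ℚ.≤ seq y n ℚ.+ ε)

-- Without abstract, the positivity checker unfolds these proofs.
private abstract
  half-pos : ∀ {ε} → 0ℚ ℚ.< ε → 0ℚ ℚ.< ½ ℚ.* ε
  half-pos {ε} 0<ε = subst (ℚ._< ½ ℚ.* ε) (ℚₚ.*-zeroʳ ½) (ℚₚ.*-monoʳ-<-pos ½ 0<ε)

  halves : ∀ ε → ½ ℚ.* ε ℚ.+ ½ ℚ.* ε ≡ ε
  halves ε = trans (sym (ℚₚ.*-distribʳ-+ ε ½ ½)) (ℚₚ.*-identityˡ ε)

  +-interchange : ∀ a b c d → (a ℚ.+ b) ℚ.+ (c ℚ.+ d) ≡ (a ℚ.+ c) ℚ.+ (b ℚ.+ d)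
  +-interchange = interchange
    where
    open import Algebra.Bundles using (CommutativeMonoid)
    open import Algebra.Properties.CommutativeSemigroup
      (CommutativeMonoid.commutativeSemigroup ℚₚ.+-0-commutativeMonoid)
      using (interchange)

  +-minus-interchange : ∀ a b c d →
    (a ℚ.- b) ℚ.+ (c ℚ.- d) ≡ (a ℚ.+ c) ℚ.- (b ℚ.+ d)
  +-minus-interchange a b c d =
    trans (+-interchange a (ℚ.- b) c (ℚ.- d))
          (cong ((a ℚ.+ c) ℚ.+_) (sym (ℚₚ.neg-distrib-+ b d)))

fromℚ : ℚ → ℝ
fromℚ q = mkℝ (λ _ → q) λ ε 0<ε →
  0 , λ _ _ _ _ → subst (λ d → ∣ d ∣ ℚ.< ε) (sym (ℚₚ.+-inverseʳ q)) 0<ε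

fromℕ : ℕ → ℝ
fromℕ c = fromℚ (ℤ.+ c ℚ./ 1)

infixl 6 _+ᵣ_

_+ᵣ_ : ℝ → ℝ → ℝ
x +ᵣ y = mkℝ (λ n → seq x n ℚ.+ seq y n) cauchy-+
  where
  cauchy-+ : IsCauchy (λ n → seq x n ℚ.+ seq y n)
  cauchy-+ ε 0<ε with cauchy x (½ ℚ.* ε) (half-pos 0<ε) | cauchy y (½ ℚ.* ε) (half-pos 0<ε)
  ... | M , hx | N , hy = M ⊔ N , λ m n m≥ n≥ →
    subst₂ ℚ._<_ (cong ∣_∣ (+-minus-interchange (seq x m) (seq x n) (seq y m) (seq y n))) (halves ε)
      (ℚₚ.≤-<-trans (ℚₚ.∣p+q∣≤∣p∣+∣q∣ (seq x m ℚ.- seq x n) (seq y m ℚ.- seq y n))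
        (ℚₚ.+-mono-< (hx m n (ℕₚ.m⊔n≤o⇒m≤o M N m≥) (ℕₚ.m⊔n≤o⇒m≤o M N n≥))
                     (hy m n (ℕₚ.m⊔n≤o⇒n≤o M N m≥) (ℕₚ.m⊔n≤o⇒n≤o M N n≥))))

record ℝ₊ : Set where
  constructor mkℝ₊
  field
    real   : ℝ
    nonneg : fromℚ 0ℚ ≤ᵣ real

open ℝ₊ public

0₊ : ℝ₊
0₊ = mkℝ₊ (fromℚ 0ℚ) λ ε 0<ε →
  0 , λ _ _ → subst (0ℚ ℚ.≤_) (sym (ℚₚ.+-identityˡ ε)) (ℚₚ.<⇒≤ 0<ε)

infixl 6 _+₊_

_+₊_ : ℝ₊ → ℝ₊ → ℝ₊
x +₊ y = mkℝ₊ (real x +ᵣ real y) nonneg-+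
  where
  nonneg-+ : fromℚ 0ℚ ≤ᵣ real x +ᵣ real y
  nonneg-+ ε 0<ε with nonneg x (½ ℚ.* ε) (half-pos 0<ε) | nonneg y (½ ℚ.* ε) (half-pos 0<ε)
  ... | M , hx | N , hy = M ⊔ N , λ n n≥ →
    subst (0ℚ ℚ.≤_)
      (trans (+-interchange (seq (real x) n) (½ ℚ.* ε) (seq (real y) n) (½ ℚ.* ε))
             (cong ((seq (real x) n ℚ.+ seq (real y) n) ℚ.+_) (halves ε)))
      (ℚₚ.+-mono-≤ (hx n (ℕₚ.m⊔n≤o⇒m≤o M N n≥)) (hy n (ℕₚ.m⊔n≤o⇒n≤o M N n≥)))

-- Throughout, the alphabet is Fin k and the clocks are Fin m.

-- Each letter carries the delay since the previous letter.
TimedWord : ℕ → Set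
TimedWord k = List (Fin k × ℝ₊)

TimedLanguage : Set₁
TimedLanguage = Σ[ k ∈ ℕ ] Pred (TimedWord k) 0ℓ

Valuation : ℕ → Set
Valuation m = Fin m → ℝ₊

v₀ : ∀ {m} → Valuation m
v₀ _ = 0₊

infixl 6 _⊕_

_⊕_ : ∀ {m} → Valuation m → ℝ₊ → Valuation m
(v ⊕ t) x = v x +₊ t

_[_:=0] : ∀ {m} → Valuation m → Subset m → Valuation m
(v [ r :=0]) x = if does (x ∈? r) then 0₊ else v x

infixr 6 _∧ᶜ_
infix  7 _<ᶜ_ _≤ᶜ_

data Constraint (m : ℕ) : Set where
  _<ᶜ_ : Fin m → ℕ → Constraint m
  _≤ᶜ_ : Fin m → ℕ → Constraint m
  _∧ᶜ_ : Constraint m → Constraint m → Constraint m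
  ¬ᶜ_  : Constraint m → Constraint m

infix 4 _⊨_

_⊨_ : ∀ {m} → Valuation m → Constraint m → Set
v ⊨ x <ᶜ c   = real (v x) <ᵣ fromℕ c
v ⊨ x ≤ᶜ c   = real (v x) ≤ᵣ fromℕ c
v ⊨ σ₁ ∧ᶜ σ₂ = v ⊨ σ₁ × v ⊨ σ₂
v ⊨ ¬ᶜ σ     = ¬ v ⊨ σ

record Rule (k m n : ℕ) : Set where
  constructor ⟨_,_,_,_,_⟩
  field
    source : Fin n
    letter : Fin k
    guard  : Constraint m
    target : Fin n
    resets : Subset m

record NTA (k m : ℕ) : Set where
  field
    locations : ℕ

  Loc : Set
  Loc = Fin locations

  field
    initial   : Loc
    accepting : Subset locations
    rules     : List (Rule k m locations)

  data Run : Loc → Valuation m → TimedWord k → Loc → Set where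
    stop : ∀ {q v} → Run q v [] q
    step : ∀ {q v a t w σ q′ r q″} →
           ⟨ q , a , σ , q′ , r ⟩ List.∈ rules →
           v ⊕ t ⊨ σ →
           Run q′ ((v ⊕ t) [ r :=0]) w q″ →
           Run q v ((a , t) ∷ w) q″

  Accepts : Pred (TimedWord k) 0ℓ
  Accepts w = ∃[ q ] (Run initial v₀ w q × q ∈ accepting)

data B⁺ (X : Set) : Set where
  atom : X → B⁺ X
  _∧_  : B⁺ X → B⁺ X → B⁺ X
  _∨_  : B⁺ X → B⁺ X → B⁺ X

data Choice : Set where
  left right : Choice

pick : ∀ {X : Set} → Choice → X → X → X
pick left  x y = x
pick right x y = y

-- On a fixed word the position reached is determined by the choices made
-- so far by both players.  A strategy for Eve maps this history, oldest
-- choice first, to her next choice.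
Strategy : Set
Strategy = List Choice → Choice

after : Choice → Strategy → Strategy
after d s h = s (d ∷ h)

record ATA (k m : ℕ) : Set where
  field
    locations : ℕ

  Loc : Set
  Loc = Fin locations

  Formula : Set
  Formula = B⁺ (Loc × Subset m)

  field
    initial   : Loc
    accepting : Subset locations
    δ         : Loc → Fin k → Constraint m → Maybe Formula

  Defined : Loc → Fin k → Constraint m → Set
  Defined q a σ = ∃[ b ] δ q a σ ≡ just b

  field
    finite   : ∀ q a → Σ[ σs ∈ List (Constraint m) ] (∀ {σ} → Defined q a σ → σ List.∈ σs)
    disjoint : ∀ q a v {σ σ′} → Defined q a σ → Defined q a σ′ →
               v ⊨ σ → v ⊨ σ′ → σ ≡ σ′
    -- Classically: some constraint in the domain holds.  Requiring a witness
    -- would demand deciding comparisons of real numbers with constants.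
    covering : ∀ q a v → ¬ (∀ σ → Defined q a σ → ¬ v ⊨ σ)

  data Position : Set where
    between : Loc → Valuation m → TimedWord k → Position
    -- Inside a phase; the valuation already includes the delay.
    within  : Formula → Valuation m → TimedWord k → Position

  -- Play s p q: some play from p in which Eve follows s ends in location q.
  data Play (s : Strategy) : Position → Loc → Set where
    finish : ∀ {q v} → Play s (between q v []) q
    phase  : ∀ {q v a t w σ b q′} →
             δ q a σ ≡ just b → v ⊕ t ⊨ σ →
             Play s (within b (v ⊕ t) w) q′ →
             Play s (between q v ((a , t) ∷ w)) q′
    adam   : ∀ {b₁ b₂ v w q′} (d : Choice) →
             Play (after d s) (within (pick d b₁ b₂) v w) q′ →
             Play s (within (b₁ ∧ b₂) v w) q′
    eve    : ∀ {b₁ b₂ v w q′} →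
             Play (after (s []) s) (within (pick (s []) b₁ b₂) v w) q′ →
             Play s (within (b₁ ∨ b₂) v w) q′
    move   : ∀ {q r v w q′} →
             Play s (between q (v [ r :=0]) w) q′ →
             Play s (within (atom (q , r)) v w) q′

  Winning : Strategy → Position → Set
  Winning s p = ∀ {q} → Play s p q → q ∈ accepting

  Accepts : Pred (TimedWord k) 0ℓ
  Accepts w = ∃[ s ] Winning s (between initial v₀ w)

NTARecognizable : Pred TimedLanguage 0ℓ
NTARecognizable (k , L) = ∃[ m ] Σ[ A ∈ NTA k m ] L ≐ NTA.Accepts A

OneClockATARecognizable : Pred TimedLanguage 0ℓ
OneClockATARecognizable (k , L) = Σ[ A ∈ ATA k 1 ] L ≐ ATA.Accepts A

{-# OPTIONS --safe #-}
module Submission where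

-- A guard sees only the integer part of a clock whose value is not an integer.
--
-- An NTA language beyond one-clock ATA: some letter comes after time 1 but
-- less than 1 after the first letter.  Once the first letter has been read at
-- time p < 1, the copies of a one-clock alternating automaton have clock p or
-- 0, and if the remaining letters fall within one time unit, the winner from
-- (q , c) depends only on q and on how many of them precede the moment at
-- which clock c reaches 1.  With more than 2 ^ |Q| possible counts, two
-- distinct ones have the same set of winning locations, so the automaton
-- cannot tell whether the two clocks reach 1 between the same two letters.
--
-- A one-clock ATA language beyond NTA (Alur and Dill): no two letters are at
-- distance 1.  Take m + 1 letters followed by m + 1 letters that come just over
-- one time unit after them.  An accepting run with m clocks keeps none of them
-- running from some letter i of the first half, so that it survives moving
-- letter i of the second half to distance exactly 1.

open import Defs
open import Data.Bool.Base using (Bool; true; false; if_then_else_) renaming (_∧_ to _&&_; _∨_ to _||_)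
open import Data.Empty using (⊥-elim)
open import Data.Fin.Base using (Fin; zero; suc; toℕ; funToFin; finToFun)
open import Data.Fin.Patterns using (0F; 1F; 2F)
import Data.Fin.Properties as Finₚ
open import Data.Fin.Subset using (Subset; inside; outside; ⁅_⁆; _∈_) renaming (⊥ to ∅)
open import Data.Fin.Subset.Properties using (_∈?_; x∈⁅x⁆; x∈⁅y⁆⇒x≡y)
import Data.Integer.Base as ℤ
import Data.Integer.Properties as ℤₚ
open import Data.List.Base using (List; []; _∷_; map; length; replicate; _++_)
import Data.List.Membership.Propositional as List
import Data.List.Properties as Listₚ
open import Data.List.Relation.Unary.All using (All; []; _∷_)
open import Data.List.Relation.Unary.Any using (here; there; any?)
import Data.Maybe.Base as Maybe
open Maybe using (Maybe; just; nothing)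
import Data.Maybe.Properties as Maybeₚ
open import Data.Nat.Base as ℕ using (ℕ; zero; suc; _+_; _*_; _<_; _≤_; s≤s; z≤n)
open import Data.Nat.DivMod using (_/_; _%_; m≡m%n+[m/n]*n; m%n<n; m/n*n≤m; m<n⇒m/n≡0; m≥n⇒m/n>0; m<n*o⇒m/o<n)
open import Data.Nat.ListAction using (sum)
import Data.Nat.Properties as ℕₚ
open import Data.Nat.Tactic.RingSolver using (solve-∀)
open import Data.Product.Base using (∃-syntax; _×_; _,_; proj₁; proj₂)
open import Data.Rational.Base as ℚ using (ℚ; 0ℚ; toℚᵘ)
import Data.Rational.Properties as ℚₚ
open import Data.Rational.Unnormalised.Base as ℚᵘ using (mkℚᵘ; *≡*; *<*; *≤*)
import Data.Rational.Unnormalised.Properties as ℚᵘₚ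
open import Data.Sum.Base using (_⊎_; inj₁; inj₂; [_,_]′)
open import Data.Vec.Base using ([]; _∷_; here; there)
open import Function.Base using (_∘_; const; id)
open import Relation.Binary.Definitions using (tri<; tri≈; tri>)
open import Relation.Binary.PropositionalEquality
open import Relation.Nullary using (¬_; Dec; yes; no; does; contradiction; _×-dec_; ¬?)
open import Relation.Unary using (_⊈_)

-- Repeated delays and comparisons of constant reals.

sum-replicate : ∀ n c → sum (replicate n c) ≡ n * c
sum-replicate zero    c = refl
sum-replicate (suc n) c = cong (c +_) (sum-replicate n c)

all-replicate : ∀ n {c} → 0 < c → All (0 <_) (replicate n c)
all-replicate zero    _   = []
all-replicate (suc n) 0<c = 0<c ∷ all-replicate n 0<c

replicate-++ : ∀ {A : Set} m n {x : A} xs → replicate (m + n) x ++ xs ≡ replicate m x ++ replicate n x ++ xs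
replicate-++ zero    n xs = refl
replicate-++ (suc m) n xs = cong (_ ∷_) (replicate-++ m n xs)

4*n+4≡4*[1+n] : ∀ n → 4 * n + 4 ≡ 4 * suc n
4*n+4≡4*[1+n] = solve-∀

const-cancel-< : ∀ x y p q → (∀ n → seq x n ≡ p) → (∀ n → seq y n ≡ q) → x <ᵣ y → p ℚ.< q
const-cancel-< x y p q x≡p y≡q (ε , 0<ε , N , x+ε≤y) = begin-strict
  p          ≡⟨ ℚₚ.+-identityʳ p ⟨
  p ℚ.+ 0ℚ   <⟨ ℚₚ.+-monoʳ-< p 0<ε ⟩
  p ℚ.+ ε    ≡⟨ cong (ℚ._+ ε) (x≡p N) ⟨
  _          ≤⟨ x+ε≤y N ℕₚ.≤-refl ⟩
  _          ≡⟨ y≡q N ⟩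
  q          ∎
  where open ℚₚ.≤-Reasoning

p+[q-p]≡q : ∀ p q → p ℚ.+ (q ℚ.- p) ≡ q
p+[q-p]≡q p q = begin
  p ℚ.+ (q ℚ.- p)       ≡⟨ cong (p ℚ.+_) (ℚₚ.+-comm q (ℚ.- p)) ⟩
  p ℚ.+ (ℚ.- p ℚ.+ q)   ≡⟨ ℚₚ.+-assoc p (ℚ.- p) q ⟨
  (p ℚ.- p) ℚ.+ q       ≡⟨ cong (ℚ._+ q) (ℚₚ.+-inverseʳ p) ⟩
  0ℚ ℚ.+ q              ≡⟨ ℚₚ.+-identityˡ q ⟩
  q                     ∎
  where open ≡-Reasoning

p<q⇒0<q-p : ∀ {p q} → p ℚ.< q → 0ℚ ℚ.< q ℚ.- p
p<q⇒0<q-p {p} {q} p<q = subst (ℚ._< q ℚ.- p) (ℚₚ.+-inverseʳ p) (ℚₚ.+-monoˡ-< (ℚ.- p) p<q)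

const-mono-< : ∀ x y p q → (∀ n → seq x n ≡ p) → (∀ n → seq y n ≡ q) → p ℚ.< q → x <ᵣ y
const-mono-< x y p q x≡p y≡q p<q = q ℚ.- p , p<q⇒0<q-p p<q , 0 , λ n _ → ℚₚ.≤-reflexive
  (trans (cong (ℚ._+ (q ℚ.- p)) (x≡p n)) (trans (p+[q-p]≡q p q) (sym (y≡q n))))

const-mono-≤ : ∀ x y p q → (∀ n → seq x n ≡ p) → (∀ n → seq y n ≡ q) → p ℚ.≤ q → x ≤ᵣ y
const-mono-≤ x y p q x≡p y≡q p≤q ε 0<ε = 0 , λ n _ →
  subst₂ ℚ._≤_ (trans (ℚₚ.+-identityʳ p) (sym (x≡p n))) (cong (ℚ._+ ε) (sym (y≡q n)))
    (ℚₚ.+-mono-≤ p≤q (ℚₚ.<⇒≤ 0<ε))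

const-cancel-≤ : ∀ x y p q → (∀ n → seq x n ≡ p) → (∀ n → seq y n ≡ q) → x ≤ᵣ y → p ℚ.≤ q
const-cancel-≤ x y p q x≡p y≡q x≤y with p ℚₚ.≤? q
... | yes p≤q = p≤q
-- With `m` strictly between `q` and `p`, the slack `m - q` lifts `q` only to `m`, still short of
-- `p`.
... | no  p≰q with ℚₚ.<-dense (ℚₚ.≰⇒> p≰q)
...   | m , q<m , m<p with x≤y (m ℚ.- q) (p<q⇒0<q-p q<m)
...     | N , x≤y+ε = ⊥-elim (ℚₚ.<-irrefl refl (ℚₚ.<-≤-trans m<p (subst₂ ℚ._≤_ (x≡p N)
            (trans (cong (ℚ._+ (m ℚ.- q)) (y≡q N)) (p+[q-p]≡q q m)) (x≤y+ε N ℕₚ.≤-refl))))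

-- All delays are multiples of a tick, 1/(4K) of a time unit.
module Ticks (k : ℕ) where

  K unit : ℕ
  K = suc k
  unit = 4 * K

  opaque
    tick : ℕ → ℚ
    tick c = ℤ.+ c ℚ./ unit

  private
    u : ℕ → ℚᵘ.ℚᵘ
    u c = mkℚᵘ (ℤ.+ c) (ℕ.pred unit)

    opaque
      unfolding tick

      tick≃u : ∀ c → toℚᵘ (tick c) ℚᵘ.≃ u c
      tick≃u c = ℚₚ.toℚᵘ-fromℚᵘ (u c)

    whole : ℕ → ℚᵘ.ℚᵘ
    whole c = mkℚᵘ (ℤ.+ c) 0

    whole≃ : ∀ c → toℚᵘ (ℤ.+ c ℚ./ 1) ℚᵘ.≃ whole c
    whole≃ c = ℚₚ.toℚᵘ-fromℚᵘ (whole c)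

  tick-+ : ∀ a b → tick a ℚ.+ tick b ≡ tick (a + b)
  tick-+ a b = ℚₚ.toℚᵘ-injective (begin
    toℚᵘ (tick a ℚ.+ tick b)          ≈⟨ ℚₚ.toℚᵘ-homo-+ (tick a) (tick b) ⟩
    toℚᵘ (tick a) ℚᵘ.+ toℚᵘ (tick b)  ≈⟨ ℚᵘₚ.+-cong (tick≃u a) (tick≃u b) ⟩
    u a ℚᵘ.+ u b                      ≈⟨ *≡* same ⟩
    u (a + b)                         ≈⟨ tick≃u (a + b) ⟨
    toℚᵘ (tick (a + b))               ∎)
    where
    open ℚᵘₚ.≃-Reasoning
    distrib : ∀ a b n → (a * n + b * n) * n ≡ (a + b) * (n * n)
    distrib = solve-∀
    same : (ℤ.+ a ℤ.* ℤ.+ unit ℤ.+ ℤ.+ b ℤ.* ℤ.+ unit) ℤ.* ℤ.+ unit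
         ≡ ℤ.+ (a + b) ℤ.* ℤ.+ (unit * unit)
    same = trans (cong₂ (λ i j → (i ℤ.+ j) ℤ.* ℤ.+ unit) (sym (ℤₚ.pos-* a unit)) (sym (ℤₚ.pos-* b unit)))
               (trans (sym (ℤₚ.pos-* (a * unit + b * unit) unit))
               (trans (cong ℤ.+_ (distrib a b unit)) (ℤₚ.pos-* (a + b) (unit * unit))))

  private
    cross : ∀ c → ℤ.+ c ℤ.* ℤ.+ 1 ≡ ℤ.+ c
    cross c = ℤₚ.*-identityʳ (ℤ.+ c)

  tick<⇒ : ∀ a c → tick a ℚ.< ℤ.+ c ℚ./ 1 → a < c * unit
  tick<⇒ a c lt with ℚᵘₚ.<-respʳ-≃ (whole≃ c) (ℚᵘₚ.<-respˡ-≃ (tick≃u a) (ℚₚ.toℚᵘ-mono-< lt))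
  ... | *<* l = ℤₚ.drop‿+<+ (subst₂ ℤ._<_ (cross a) (sym (ℤₚ.pos-* c unit)) l)

  tick<⇐ : ∀ a c → a < c * unit → tick a ℚ.< ℤ.+ c ℚ./ 1
  tick<⇐ a c lt = ℚₚ.toℚᵘ-cancel-< (ℚᵘₚ.<-respʳ-≃ (ℚᵘₚ.≃-sym (whole≃ c)) (ℚᵘₚ.<-respˡ-≃ (ℚᵘₚ.≃-sym (tick≃u a))
    (*<* (subst₂ ℤ._<_ (sym (cross a)) (ℤₚ.pos-* c unit) (ℤ.+<+ lt)))))

  tick≤⇒ : ∀ a c → tick a ℚ.≤ ℤ.+ c ℚ./ 1 → a ≤ c * unit
  tick≤⇒ a c le with ℚᵘₚ.≤-respʳ-≃ (whole≃ c) (ℚᵘₚ.≤-respˡ-≃ (tick≃u a) (ℚₚ.toℚᵘ-mono-≤ le))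
  ... | *≤* l = ℤₚ.drop‿+≤+ (subst₂ ℤ._≤_ (cross a) (sym (ℤₚ.pos-* c unit)) l)

  tick≤⇐ : ∀ a c → a ≤ c * unit → tick a ℚ.≤ ℤ.+ c ℚ./ 1
  tick≤⇐ a c le = ℚₚ.toℚᵘ-cancel-≤ (ℚᵘₚ.≤-respʳ-≃ (ℚᵘₚ.≃-sym (whole≃ c)) (ℚᵘₚ.≤-respˡ-≃ (ℚᵘₚ.≃-sym (tick≃u a))
    (*≤* (subst₂ ℤ._≤_ (sym (cross a)) (ℤₚ.pos-* c unit) (ℤ.+≤+ le)))))

  infix 4 _≈_
  record _≈_ (x : ℝ₊) (c : ℕ) : Set where
    constructor constantly
    field
      at : ∀ n → seq (real x) n ≡ tick c

  open _≈_

  0≤tick : ∀ d → 0ℚ ℚ.≤ tick d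
  0≤tick d = ℚₚ.toℚᵘ-cancel-≤ (ℚᵘₚ.≤-respʳ-≃ (ℚᵘₚ.≃-sym (tick≃u d))
    (*≤* (subst₂ ℤ._≤_ (sym (ℤₚ.*-zeroˡ (ℤ.+ unit))) (sym (cross d)) (ℤ.+≤+ z≤n))))

  opaque
    delay : ℕ → ℝ₊
    delay d = mkℝ₊ (fromℚ (tick d))
      (const-mono-≤ (fromℚ 0ℚ) (fromℚ (tick d)) 0ℚ (tick d) (λ _ → refl) (λ _ → refl) (0≤tick d))

    delay≈ : ∀ d → delay d ≈ d
    delay≈ d = constantly λ _ → refl

  0₊≈0 : 0₊ ≈ 0
  0₊≈0 = constantly λ _ → ℚₚ.toℚᵘ-injective (ℚᵘₚ.≃-trans (*≡* refl) (ℚᵘₚ.≃-sym (tick≃u 0)))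

  +-≈ : ∀ {x : ℝ₊} {c} → x ≈ c → ∀ d → x +₊ delay d ≈ c + d
  +-≈ {c = c} x≈c d = constantly λ n → trans (cong₂ ℚ._+_ (at x≈c n) (at (delay≈ d) n)) (tick-+ c d)

  module _ {x : ℝ₊} {c} (x≈c : x ≈ c) where

    <-≈⇒ : ∀ b → real x <ᵣ fromℕ b → c < b * unit
    <-≈⇒ b = tick<⇒ c b ∘ const-cancel-< (real x) (fromℕ b) (tick c) (ℤ.+ b ℚ./ 1) (at x≈c) (λ _ → refl)

    <-≈⇐ : ∀ b → c < b * unit → real x <ᵣ fromℕ b
    <-≈⇐ b = const-mono-< (real x) (fromℕ b) (tick c) (ℤ.+ b ℚ./ 1) (at x≈c) (λ _ → refl) ∘ tick<⇐ c b

    ≤-≈⇒ : ∀ b → real x ≤ᵣ fromℕ b → c ≤ b * unit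
    ≤-≈⇒ b = tick≤⇒ c b ∘ const-cancel-≤ (real x) (fromℕ b) (tick c) (ℤ.+ b ℚ./ 1) (at x≈c) (λ _ → refl)

    ≤-≈⇐ : ∀ b → c ≤ b * unit → real x ≤ᵣ fromℕ b
    ≤-≈⇐ b = const-mono-≤ (real x) (fromℕ b) (tick c) (ℤ.+ b ℚ./ 1) (at x≈c) (λ _ → refl) ∘ tick≤⇐ c b

-- Guards on clocks with non-integer values.

infix 4 _⊩_

-- Satisfaction when f x is the integer part of a clock x with non-integer
-- value, for which x < c and x ≤ c are equivalent.
_⊩_ : ∀ {m} → (Fin m → ℕ) → Constraint m → Set
f ⊩ x <ᶜ c   = f x < c
f ⊩ x ≤ᶜ c   = f x < c
f ⊩ σ₁ ∧ᶜ σ₂ = f ⊩ σ₁ × f ⊩ σ₂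
f ⊩ ¬ᶜ σ     = ¬ f ⊩ σ

⊩? : ∀ {m} (f : Fin m → ℕ) σ → Dec (f ⊩ σ)
⊩? f (x <ᶜ c)   = f x ℕₚ.<? c
⊩? f (x ≤ᶜ c)   = f x ℕₚ.<? c
⊩? f (σ₁ ∧ᶜ σ₂) = ⊩? f σ₁ ×-dec ⊩? f σ₂
⊩? f (¬ᶜ σ)     = ¬? (⊩? f σ)

-- Refuting a contradiction requires no comparison of reals, so this guard passes for arbitrary
-- delays.
⊤ᶜ : ∀ {m} → Constraint (suc m)
⊤ᶜ = ¬ᶜ ((zero <ᶜ 0) ∧ᶜ (¬ᶜ (zero <ᶜ 0)))

⊨-⊤ᶜ : ∀ {m} {v : Valuation (suc m)} → v ⊨ ⊤ᶜ
⊨-⊤ᶜ (l , ¬l) = ¬l l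

-- Determining the winner of the acceptance game.

evalᵇ : ∀ {X : Set} → (X → Bool) → B⁺ X → Bool
evalᵇ g (atom x) = g x
evalᵇ g (b ∧ c)  = evalᵇ g b && evalᵇ g c
evalᵇ g (b ∨ c)  = evalᵇ g b || evalᵇ g c

evalᵇ-cong : ∀ {X : Set} {g h : X → Bool} → g ≗ h → evalᵇ g ≗ evalᵇ h
evalᵇ-cong g≗h (atom x) = g≗h x
evalᵇ-cong g≗h (b ∧ c)  = cong₂ _&&_ (evalᵇ-cong g≗h b) (evalᵇ-cong g≗h c)
evalᵇ-cong g≗h (b ∨ c)  = cong₂ _||_ (evalᵇ-cong g≗h b) (evalᵇ-cong g≗h c)

module Game {k m} (A : ATA k m) where
  open ATA A

  -- A Boolean naming the winner lets the outcomes on two words be compared by an equality.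
  Decides : Position → Bool → Set
  Decides p true  = ∃[ s ] Winning s p
  Decides p false = ∀ s → ¬ Winning s p

  decides-between-[] : ∀ q v → Decides (between q v []) (does (q ∈? accepting))
  decides-between-[] q v with q ∈? accepting
  ... | yes q∈F = (λ _ → left) , λ { finish → q∈F }
  ... | no  q∉F = λ _ win → q∉F (win finish)

  -- Adam's choice is the first entry of the history, so one strategy can continue as `s₁` or `s₂`
  -- accordingly; a lost conjunct is the one Adam picks.
  decides-∧ : ∀ {b₁ b₂ v w} β₁ β₂ → Decides (within b₁ v w) β₁ → Decides (within b₂ v w) β₂ →
              Decides (within (b₁ ∧ b₂) v w) (β₁ && β₂)
  decides-∧ true  true  (s₁ , win₁) (s₂ , win₂) = s , λ { (adam left p) → win₁ p ; (adam right p) → win₂ p }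
    where
    s : Strategy
    s []          = left
    s (left ∷ h)  = s₁ h
    s (right ∷ h) = s₂ h
  decides-∧ true  false _    lost = λ s win → lost (after right s) (win ∘ adam right)
  decides-∧ false _     lost _    = λ s win → lost (after left s) (win ∘ adam left)

  decides-∨ : ∀ {b₁ b₂ v w} β₁ β₂ → Decides (within b₁ v w) β₁ → Decides (within b₂ v w) β₂ →
              Decides (within (b₁ ∨ b₂) v w) (β₁ || β₂)
  decides-∨ true  _     (s₁ , win₁) _ = s , λ { (eve p) → win₁ p }
    where
    s : Strategy
    s []      = left
    s (_ ∷ h) = s₁ h
  decides-∨ false true  _ (s₂ , win₂) = s , λ { (eve p) → win₂ p }
    where
    s : Strategy
    s []      = right
    s (_ ∷ h) = s₂ h
  decides-∨ {b₁} {b₂} {v} {w} false false lost₁ lost₂ = λ s win → lost s (s []) (win ∘ eve)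
    where
    lost : ∀ s d → ¬ Winning (after d s) (within (pick d b₁ b₂) v w)
    lost s left  = lost₁ (after left s)
    lost s right = lost₂ (after right s)

  decides-within : ∀ {v w} {g : Loc × Subset m → Bool} →
                   (∀ q r → Decides (between q (v [ r :=0]) w) (g (q , r))) →
                   ∀ b → Decides (within b v w) (evalᵇ g b)
  decides-within {v} {w} {g} dec (atom (q , r)) with g (q , r) | dec q r
  ... | true  | s , win = s , λ { (move p) → win p }
  ... | false | lost    = λ s win → lost s (win ∘ move)
  decides-within {g = g} dec (b ∧ c) = decides-∧ (evalᵇ g b) (evalᵇ g c) (decides-within dec b) (decides-within dec c)
  decides-within {g = g} dec (b ∨ c) = decides-∨ (evalᵇ g b) (evalᵇ g c) (decides-within dec b) (decides-within dec c)

  decides-phase : ∀ {q v a t w σ b} β → δ q a σ ≡ just b → v ⊕ t ⊨ σ →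
                  Decides (within b (v ⊕ t) w) β → Decides (between q v ((a , t) ∷ w)) β
  decides-phase {q} {v} {a} {t} {b = b} true δ≡b sat (s , win) =
    s , λ { (phase δ≡b′ sat′ p) → win (subst (λ b → Play s (within b _ _) _) (same δ≡b′ sat′) p) }
    where
    -- A play brings its own constraint and formula; `disjoint` forces them to be `σ` and `b`.
    same : ∀ {σ′ b′} → δ q a σ′ ≡ just b′ → v ⊕ t ⊨ σ′ → b′ ≡ b
    same δ≡b′ sat′ with refl ← disjoint q a (v ⊕ t) (_ , δ≡b′) (_ , δ≡b) sat′ sat =
      Maybeₚ.just-injective (trans (sym δ≡b′) δ≡b)
  decides-phase false δ≡b sat lost = λ s win → lost s (win ∘ phase δ≡b sat)

  decides-unique : ∀ {p} β₁ β₂ → Decides p β₁ → Decides p β₂ → β₁ ≡ β₂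
  decides-unique true  true  _ _ = refl
  decides-unique false false _ _ = refl
  decides-unique true  false (s , win) lost = ⊥-elim (lost s win)
  decides-unique false true  lost (s , win) = ⊥-elim (lost s win)

-- Integer parts of clocks along a word.

module Floors (k : ℕ) where
  open Ticks k public

  word : List ℕ → TimedWord 1
  word = map (λ d → zero , delay d)

  infix 4 _HasFloor_ _Floor_

  record _HasFloor_ (c f : ℕ) : Set where
    constructor _,_
    field
      above : f * unit < c   -- strict: c is not a whole number of units
      below : c < suc f * unit

  open _HasFloor_

  module _ {c f b : ℕ} (c-f : c HasFloor f) where

    floor-< : c ≤ b * unit → f < b
    floor-< c≤b = ℕₚ.*-cancelʳ-< unit f b (ℕₚ.<-≤-trans (above c-f) c≤b)

    <-floor : f < b → c < b * unit
    <-floor f<b = ℕₚ.<-≤-trans (below c-f) (ℕₚ.*-monoˡ-≤ unit f<b)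

  record _Floor_ (x : ℝ₊) (f : ℕ) : Set where
    constructor floor
    field
      {ticks}  : ℕ
      value≈   : x ≈ ticks
      hasFloor : ticks HasFloor f

  module _ {m} {v : Valuation m} {f : Fin m → ℕ} (v-f : ∀ x → v x Floor f x) where

    mutual
      ⊩⇒⊨ : ∀ σ → f ⊩ σ → v ⊨ σ
      ⊩⇒⊨ (x <ᶜ c)   f<c       = let floor v≈ fl = v-f x in <-≈⇐ v≈ c (<-floor fl f<c)
      ⊩⇒⊨ (x ≤ᶜ c)   f<c       = let floor v≈ fl = v-f x in ≤-≈⇐ v≈ c (ℕₚ.<⇒≤ (<-floor fl f<c))
      ⊩⇒⊨ (σ₁ ∧ᶜ σ₂) (s₁ , s₂) = ⊩⇒⊨ σ₁ s₁ , ⊩⇒⊨ σ₂ s₂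
      ⊩⇒⊨ (¬ᶜ σ)     ¬s        = ¬s ∘ ⊨⇒⊩ σ

      ⊨⇒⊩ : ∀ σ → v ⊨ σ → f ⊩ σ
      ⊨⇒⊩ (x <ᶜ c)   v<c       = let floor v≈ fl = v-f x in floor-< fl (ℕₚ.<⇒≤ (<-≈⇒ v≈ c v<c))
      ⊨⇒⊩ (x ≤ᶜ c)   v≤c       = let floor v≈ fl = v-f x in floor-< fl (≤-≈⇒ v≈ c v≤c)
      ⊨⇒⊩ (σ₁ ∧ᶜ σ₂) (s₁ , s₂) = ⊨⇒⊩ σ₁ s₁ , ⊨⇒⊩ σ₂ s₂
      ⊨⇒⊩ (¬ᶜ σ)     ¬s        = ¬s ∘ ⊩⇒⊨ σ

  -- The value lies strictly between consecutive multiples of 4, and multiples of `unit = 4 * K` are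
  -- among these, so it is no integer and has the integer part of `a / K`.
  slot-floor : ∀ a r → r < 3 → 4 * a + suc r HasFloor a / K
  slot-floor a r r<3 = lower , upper
    where
    open ℕₚ.≤-Reasoning
    assoc : ∀ q n → q * (4 * n) ≡ 4 * (q * n)
    assoc = solve-∀
    lower : (a / K) * unit < 4 * a + suc r
    lower = begin-strict
      (a / K) * unit     ≡⟨ assoc (a / K) K ⟩
      4 * ((a / K) * K)  ≤⟨ ℕₚ.*-monoʳ-≤ 4 (m/n*n≤m a K) ⟩
      4 * a              <⟨ ℕₚ.m<m+n (4 * a) (s≤s z≤n) ⟩
      4 * a + suc r      ∎
    a<next : a < suc (a / K) * K
    a<next = begin-strict
      a                    ≡⟨ m≡m%n+[m/n]*n a K ⟩
      a % K + (a / K) * K  <⟨ ℕₚ.+-monoˡ-< ((a / K) * K) (m%n<n a K) ⟩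
      suc (a / K) * K      ∎
    upper : 4 * a + suc r < suc (a / K) * unit
    upper = begin-strict
      4 * a + suc r          <⟨ ℕₚ.+-monoʳ-< (4 * a) (s≤s r<3) ⟩
      4 * a + 4              ≡⟨ 4*n+4≡4*[1+n] a ⟩
      4 * suc a              ≤⟨ ℕₚ.*-monoʳ-≤ 4 a<next ⟩
      4 * (suc (a / K) * K)  ≡⟨ assoc (suc (a / K)) K ⟨
      suc (a / K) * unit     ∎

  -- Fits c ds a: for a clock starting at c, the i-th letter (from 1) of the
  -- delays ds is read between ⌊(a+i)/K⌋ and the next unit.  Typically c lies
  -- strictly between 4a and 4(a+1), and the delays are 4.
  data Fits : ℕ → List ℕ → ℕ → Set where
    []  : ∀ {c a} → Fits c [] a
    _∷_ : ∀ {c d ds a} → c + d HasFloor suc a / K → Fits (c + d) ds (suc a) → Fits c (d ∷ ds) a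

  -- A clock reset at any letter fits the remaining delays.
  data Fresh : List ℕ → Set where
    []  : Fresh []
    _∷_ : ∀ {d ds} → Fits 0 ds 0 → Fresh ds → Fresh (d ∷ ds)

  reset-≈ : ∀ {m} (v : Valuation m) r x {c} → v x ≈ c → (v [ r :=0]) x ≈ (if does (x ∈? r) then 0 else c)
  reset-≈ v r x v≈c with does (x ∈? r)
  ... | true  = 0₊≈0
  ... | false = v≈c

  reset-fits : ∀ {m} (r : Subset m) x {c ds a b} → Fits 0 ds b → Fits c ds a →
               Fits (if does (x ∈? r) then 0 else c) ds (if does (x ∈? r) then b else a)
  reset-fits r x fit₀ fit with does (x ∈? r)
  ... | true  = fit₀
  ... | false = fit

  slots-fit : ∀ {c} n a r → r < 3 → c ≡ 4 * a + suc r → Fits c (replicate n 4) a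
  slots-fit zero    a r r<3 eq = []
  slots-fit {c} (suc n) a r r<3 eq =
    subst (_HasFloor suc a / K) (sym next) (slot-floor (suc a) r r<3) ∷ slots-fit n (suc a) r r<3 next
    where
    shift : ∀ a r → 4 * a + suc r + 4 ≡ 4 * suc a + suc r
    shift = solve-∀
    next : c + 4 ≡ 4 * suc a + suc r
    next = trans (cong (_+ 4) eq) (shift a r)

  -- All values stay strictly between 0 and `unit` and all indices below `K`, so the actual and the
  -- predicted integer parts are both 0.
  short-fits : ∀ {ds} c a → All (0 <_) ds → c + sum ds < unit → a + length ds < K → Fits c ds a
  short-fits c a []                            _   _   = []
  short-fits {d ∷ ds} c a (0<d ∷ 0<ds) c<u a<K =
    subst (c + d HasFloor_) (sym (m<n⇒m/n≡0 (ℕₚ.≤-<-trans (ℕₚ.m≤m+n (suc a) (length ds)) a<K′)))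
      (ℕₚ.<-≤-trans 0<d (ℕₚ.m≤n+m d c) ,
       subst (c + d <_) (sym (ℕₚ.+-identityʳ unit)) (ℕₚ.≤-<-trans (ℕₚ.m≤m+n (c + d) (sum ds)) c<u′))
    ∷ short-fits (c + d) (suc a) 0<ds c<u′ a<K′
    where
    a<K′ : suc a + length ds < K
    a<K′ = subst (_< K) (ℕₚ.+-suc a (length ds)) a<K
    c<u′ : c + d + sum ds < unit
    c<u′ = subst (_< unit) (sym (ℕₚ.+-assoc c d (sum ds))) c<u

  short-fresh : ∀ {d ds} → All (0 <_) ds → sum ds < unit → length ds < K → Fresh (d ∷ ds)
  short-fresh {ds = []}     []           s l = [] ∷ []
  short-fresh {ds = d ∷ ds} 0<all@(_ ∷ 0<ds) s l =
    short-fits 0 0 0<all s l ∷ short-fresh 0<ds (ℕₚ.≤-<-trans (ℕₚ.m≤n+m (sum ds) d) s) (ℕₚ.<-trans ℕₚ.≤-refl l)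

-- The winner for a one-clock automaton, computed from indices.

module Abstraction (k : ℕ) (A : ATA 1 1) where
  open Floors k
  open ATA A
  open Game A

  private
    sample : ℕ → Valuation 1
    sample z _ = delay (suc (z * unit))

    sample-floor : ∀ z x → sample z x Floor z
    sample-floor z _ = floor (delay≈ _) (ℕₚ.≤-refl , ℕₚ.+-monoˡ-< (z * unit) 1<unit)
      where
      1<unit : 1 < unit
      1<unit = ℕₚ.≤-trans (s≤s (s≤s z≤n)) (ℕₚ.*-monoʳ-≤ 4 (s≤s (z≤n {k})))

    defined? : ∀ q σ → Dec (Defined q zero σ)
    defined? q σ with δ q zero σ
    ... | just b  = yes (b , refl)
    ... | nothing = no λ ()

    -- `covering` only refutes that no constraint holds. On integer parts satisfaction is decidable,
    -- so searching the finite list must succeed: a failure would contradict `covering` at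
    -- `sample z`.
    choose : ∀ q z → ∃[ σ ] (Defined q zero σ × (λ _ → z) ⊩ σ)
    choose q z with any? (λ σ → defined? q σ ×-dec ⊩? (λ _ → z) σ) (proj₁ (finite q zero))
    ... | yes any = let σ , _ , p = List.find any in σ , p
    ... | no none = ⊥-elim (covering q zero (sample z) λ σ def sat →
                      none (List.lose (proj₂ (finite q zero) def) (def , ⊨⇒⊩ (sample-floor z) σ sat)))

  formula : Loc → ℕ → Formula
  formula q z = let _ , (b , _) , _ = choose q z in b

  decides-letter : ∀ {q v d w z} β → (v ⊕ delay d) zero Floor z →
                   Decides (within (formula q z) (v ⊕ delay d) w) β → Decides (between q v ((zero , delay d) ∷ w)) β
  decides-letter {q} {z = z} β fl with choose q z
  ... | σ , (b , δ≡b) , sat = decides-phase β δ≡b (⊩⇒⊨ (λ { zero → fl }) σ sat)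

  -- The winner from location q, when n letters remain and the clock fits them
  -- with parameter a.
  value : Loc → ℕ → ℕ → Bool
  value q a zero    = does (q ∈? accepting)
  value q a (suc n) = evalᵇ (λ (q′ , r) → value q′ (if does (zero ∈? r) then 0 else suc a) n) (formula q (suc a / K))

  -- The index is all that matters: a kept clock advances it to `suc a`, and a reset clock fits the
  -- rest from index 0 by `Fresh`.
  decides-value : ∀ {c a ds} q v → v zero ≈ c → Fits c ds a → Fresh ds →
                  Decides (between q v (word ds)) (value q a (length ds))
  decides-value q v v≈c [] _ = decides-between-[] q v
  decides-value {c} {a} {d ∷ ds} q v v≈c (fl ∷ fits) (fits₀ ∷ fresh) =
    decides-letter {q} {v} {d} (value q a (suc (length ds))) (floor (+-≈ v≈c d) fl)
      (decides-within next (formula q (suc a / K)))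
    where
    next : ∀ q′ r → Decides (between q′ ((v ⊕ delay d) [ r :=0]) (word ds))
                            (value q′ (if does (zero ∈? r) then 0 else suc a) (length ds))
    next q′ r = decides-value q′ _ (reset-≈ (v ⊕ delay d) r zero (+-≈ v≈c d)) (reset-fits r zero fits₀ fits) fresh

-- A language beyond one-clock alternating automata.

module Straddling where

  -- Clock `0F` is never reset and shows absolute time; clock `1F` is reset by the first letter
  -- only.
  straddled : Constraint 2
  straddled = (¬ᶜ (0F <ᶜ 1)) ∧ᶜ (1F <ᶜ 1)

  straddling : NTA 1 2
  straddling = record
    { locations = 3
    ; initial   = 0F
    ; accepting = ⁅ 2F ⁆
    ; rules     = ⟨ 0F , 0F , ⊤ᶜ , 1F , ⁅ 1F ⁆ ⟩
                ∷ ⟨ 1F , 0F , ⊤ᶜ , 1F , ∅ ⟩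
                ∷ ⟨ 1F , 0F , straddled , 2F , ∅ ⟩
                ∷ ⟨ 2F , 0F , ⊤ᶜ , 2F , ∅ ⟩
                ∷ []
    }

  open NTA straddling

  pattern rule₀ = here refl
  pattern rule₁ = there (here refl)
  pattern rule₂ = there (there (here refl))
  pattern rule₃ = there (there (there (here refl)))

  stay : ∀ v w → Run 2F v w 2F
  stay v []             = stop
  stay v ((0F , t) ∷ w) = step {σ = ⊤ᶜ} rule₃ (⊨-⊤ᶜ {v = v ⊕ t}) (stay _ w)

  module _ (k : ℕ) where
    open Floors k

    pair : ℕ → ℕ → Fin 2 → ℕ
    pair f g 0F = f
    pair f g 1F = g

    floors₂ : ∀ (v : Valuation 2) {f g} → v 0F Floor f → v 1F Floor g → ∀ x → v x Floor pair f g x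
    floors₂ v p q 0F = p
    floors₂ v p q 1F = q

    -- The run waits for the letter that brings the index of `0F` to `K`. The index of `1F` is still
    -- smaller there, so its integer part is 0.
    finds : ∀ {c₀ c₁ a₀ a₁ ds} v → v 0F ≈ c₀ → v 1F ≈ c₁ → Fits c₀ ds a₀ → Fits c₁ ds a₁ →
            a₁ < a₀ → a₀ < K → K ≤ a₀ + length ds → Run 1F v (word ds) 2F
    finds {a₀ = a₀} v v₀≈ v₁≈ [] [] a₁<a₀ a₀<K K≤ =
      contradiction (ℕₚ.≤-trans K≤ (ℕₚ.≤-reflexive (ℕₚ.+-identityʳ a₀))) (ℕₚ.<⇒≱ a₀<K)
    finds {a₀ = a₀} {a₁} {d ∷ ds} v v₀≈ v₁≈ (fl₀ ∷ fits₀) (fl₁ ∷ fits₁) a₁<a₀ a₀<K K≤ with suc a₀ ℕₚ.<? K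
    ... | yes 1+a₀<K = step {σ = ⊤ᶜ} rule₁ (⊨-⊤ᶜ {v = v ⊕ delay d})
          (finds _ (+-≈ v₀≈ d) (+-≈ v₁≈ d) fits₀ fits₁ (s≤s a₁<a₀) 1+a₀<K
            (subst (K ≤_) (ℕₚ.+-suc a₀ (length ds)) K≤))
    ... | no  1+a₀≮K = step rule₂
          (⊩⇒⊨ (floors₂ (v ⊕ delay d) (floor (+-≈ v₀≈ d) fl₀) (floor (+-≈ v₁≈ d) fl₁)) straddled
            (ℕₚ.≤⇒≯ (m≥n⇒m/n>0 (ℕₚ.≮⇒≥ 1+a₀≮K)) , s≤s (ℕₚ.≤-reflexive (m<n⇒m/n≡0 (ℕₚ.≤-<-trans a₁<a₀ a₀<K)))))
          (stay _ (word ds))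

    -- Equal indices give both clocks equal integer parts at each letter, while `straddled`
    -- separates them at 1.
    misses : ∀ {c₀ c₁ a ds q} v → v 0F ≈ c₀ → v 1F ≈ c₁ → Fits c₀ ds a → Fits c₁ ds a →
             Run 1F v (word ds) q → q ≡ 1F
    misses v v₀≈ v₁≈ []            _             stop                = refl
    misses v v₀≈ v₁≈ (fl₀ ∷ fits₀) (fl₁ ∷ fits₁) (step rule₁ _ run) =
      misses _ (+-≈ v₀≈ _) (+-≈ v₁≈ _) fits₀ fits₁ run
    misses v v₀≈ v₁≈ (_ ∷ _) _ (step (there (there (there (here ())))) _ _)
    misses v v₀≈ v₁≈ (fl₀ ∷ fits₀) (fl₁ ∷ fits₁) (step rule₂ sat _) =
      let ¬lo , lo = ⊨⇒⊩ (floors₂ (v ⊕ delay _) (floor (+-≈ v₀≈ _) fl₀) (floor (+-≈ v₁≈ _) fl₁)) straddled sat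
      in contradiction lo ¬lo

    -- In the word with delays p e, a clock reset at the first letter then has
    -- values 4(e+i)+1, and one that is not reset has values 4(p+e+i)+2.
    tail : ℕ → List ℕ
    tail e = 4 * suc e + 1 ∷ replicate k 4

    delays : ℕ → ℕ → List ℕ
    delays p e = 4 * p + 1 ∷ tail e

    tail-length : ∀ e → length (tail e) ≡ K
    tail-length e = cong suc (Listₚ.length-replicate k)

    fits-reset : ∀ e → Fits 0 (tail e) e
    fits-reset e = slot-floor (suc e) 0 (s≤s z≤n) ∷ slots-fit k (suc e) 0 (s≤s z≤n) refl

    fits-kept : ∀ p e → Fits (4 * p + 1) (tail e) (p + e)
    fits-kept p e = subst (_HasFloor suc (p + e) / K) (sym (eq p e)) (slot-floor (suc (p + e)) 1 (s≤s (s≤s z≤n)))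
                  ∷ slots-fit k (suc (p + e)) 1 (s≤s (s≤s z≤n)) (eq p e)
      where
      eq : ∀ p e → 4 * p + 1 + (4 * suc e + 1) ≡ 4 * suc (p + e) + 2
      eq = solve-∀

    fresh-tail : ∀ e → Fresh (tail e)
    fresh-tail e = short-fresh (all-replicate k (s≤s z≤n))
      (subst (_< unit) (sym (trans (sum-replicate k 4) (ℕₚ.*-comm k 4))) (ℕₚ.*-monoʳ-< 4 (ℕₚ.n<1+n k)))
      (subst (_< K) (sym (Listₚ.length-replicate k)) (ℕₚ.n<1+n k))

    -- After the first letter `0F` has index `p + e` and `1F` has index `e`; the `K` letters of the
    -- tail are enough for the larger index to reach `K`.
    accepts-late : ∀ p e → 0 < p → p + e < K → Accepts (word (delays p e))
    accepts-late p e 0<p p+e<K = 2F , step {σ = ⊤ᶜ} rule₀ (⊨-⊤ᶜ {v = v₀ {2} ⊕ delay (4 * p + 1)})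
      (finds _ (+-≈ 0₊≈0 (4 * p + 1)) 0₊≈0 (fits-kept p e) (fits-reset e) (ℕₚ.m<n+m e 0<p) p+e<K
        (subst (K ≤_) (cong (p + e +_) (sym (tail-length e))) (ℕₚ.m≤n+m K (p + e))))
      , x∈⁅x⁆ 2F

    rejects-equal : ∀ e → ¬ Accepts (word (delays 0 e))
    rejects-equal e (q , step rule₀ _ run , q∈F)
      with refl ← misses _ (+-≈ 0₊≈0 1) 0₊≈0 (fits-kept 0 e) (fits-reset e) run
      with () ← x∈⁅y⁆⇒x≡y 2F q∈F
    rejects-equal e (q , step (there (here ())) _ _ , _)
    rejects-equal e (q , step (there (there (here ()))) _ _ , _)
    rejects-equal e (q , step (there (there (there (here ())))) _ _ , _)

  -- Pigeonhole against a one-clock automaton.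

  module _ (A : ATA 1 1) where
    private
      -- A set of winning locations is coded in `Fin k`, one element fewer than the `K = suc k`
      -- indices used in `collision`.
      k = 2 ℕ.^ ATA.locations A
    open Floors k
    open Abstraction k A
    open Game A

    bits : ℕ → ATA.Loc A → Bool
    bits e q = value q e K

    whole : ℕ → ℕ → Bool
    whole p e = evalᵇ (λ (q , r) → bits (if does (zero ∈? r) then e else p + e) q) (formula (ATA.initial A) 0)

    decides-whole : ∀ p e → p < K → Decides (ATA.between (ATA.initial A) v₀ (word (delays k p e))) (whole p e)
    decides-whole p e p<K =
      decides-letter (whole p e) (floor (+-≈ 0₊≈0 (4 * p + 1))
                                  (subst (4 * p + 1 HasFloor_) (m<n⇒m/n≡0 p<K) (slot-floor p 0 (s≤s z≤n))))
        (decides-within next (formula (ATA.initial A) 0))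
      where
      next : ∀ q r → Decides (ATA.between q ((v₀ ⊕ delay (4 * p + 1)) [ r :=0]) (word (tail k e)))
                             (bits (if does (zero ∈? r) then e else p + e) q)
      next q r = subst (after-first ∘ value q (if does (zero ∈? r) then e else p + e)) (tail-length k e) decided
        where
        after-first : Bool → Set
        after-first = Decides (ATA.between q ((v₀ ⊕ delay (4 * p + 1)) [ r :=0]) (word (tail k e)))
        decided : after-first (value q (if does (zero ∈? r) then e else p + e) (length (tail k e)))
        decided = decides-value q _ (reset-≈ (v₀ ⊕ delay (4 * p + 1)) r zero (+-≈ 0₊≈0 (4 * p + 1)))
          (reset-fits r zero (fits-reset k e) (fits-kept k p e)) (fresh-tail k e)

    toFin2 : Bool → Fin 2
    toFin2 true  = 1F
    toFin2 false = 0F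

    toFin2-injective : ∀ {b c} → toFin2 b ≡ toFin2 c → b ≡ c
    toFin2-injective {true}  {true}  _ = refl
    toFin2-injective {false} {false} _ = refl

    collision : ∃[ d ] ∃[ e ] (d < e × e < K × (∀ q → bits d q ≡ bits e q))
    collision =
      let code = λ (i : Fin K) → funToFin (toFin2 ∘ bits (toℕ i))
          i , j , i<j , code≡ = Finₚ.pigeonhole (ℕₚ.n<1+n k) code
      in toℕ i , toℕ j , i<j , Finₚ.toℕ<n j , λ q → toFin2-injective
           (trans (sym (Finₚ.finToFun-funToFin (toFin2 ∘ bits (toℕ i)) q))
           (trans (cong (λ c → finToFun c q) code≡) (Finₚ.finToFun-funToFin (toFin2 ∘ bits (toℕ j)) q)))

    straddling-not-ata : ¬ (∀ {w} → (NTA.Accepts straddling w → ATA.Accepts A w) ×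
                                    (ATA.Accepts A w → NTA.Accepts straddling w))
    straddling-not-ata same =
      let d , e , d<e , e<K , d~e = collision
          -- With this `p` a kept clock has index `e` in `delays p d` but `d` in `delays 0 d`; a
          -- reset clock has index `d` in both.
          p     = e ℕ.∸ d
          p+d≡e = ℕₚ.m∸n+n≡m (ℕₚ.<⇒≤ d<e)
          agree : whole p d ≡ whole 0 d
          agree = evalᵇ-cong (λ (q , r) → same-bits (d~e q) p+d≡e (does (zero ∈? r))) (formula (ATA.initial A) 0)
          acc   = proj₁ same (accepts-late k p d (ℕₚ.m<n⇒0<n∸m d<e) (subst (_< K) (sym p+d≡e) e<K))
          wins  = decides-unique (whole p d) true
                    (decides-whole p d (ℕₚ.≤-<-trans (ℕₚ.m∸n≤m e d) e<K)) acc
      in rejects-equal k d (proj₂ same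
           (subst (Decides (ATA.between (ATA.initial A) v₀ (word (delays k 0 d)))) (trans (sym agree) wins)
             (decides-whole 0 d (s≤s z≤n))))
      where
      same-bits : ∀ {d e p q} → bits d q ≡ bits e q → p + d ≡ e → ∀ b →
                  bits (if b then d else p + d) q ≡ bits (if b then d else d) q
      same-bits _   _    true  = refl
      same-bits d~e refl false = sym d~e

-- Missed values and displaced letters.

missed-value : ∀ {m} (g : Fin m → ℕ) → ∃[ n ] (n ≤ m × (∀ x → g x ≢ n))
missed-value {m} g =
  let i , none = Finₚ.¬∀⟶∃¬ (suc m) (λ i → ∃[ x ] g x ≡ toℕ i) (λ i → Finₚ.any? (λ x → g x ℕₚ.≟ toℕ i)) not-all
  in toℕ i , ℕₚ.≤-pred (Finₚ.toℕ<n i) , λ x gx≡i → none (x , gx≡i)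
  where
  -- Preimages of the `m + 1` numbers would be distinct elements of `Fin m`.
  not-all : ¬ (∀ i → ∃[ x ] g x ≡ toℕ i)
  not-all hit =
    let i , j , i<j , same = Finₚ.pigeonhole (ℕₚ.n<1+n m) (proj₁ ∘ hit)
    in ℕₚ.<⇒≢ i<j (trans (sym (proj₂ (hit i))) (trans (cong g same) (proj₂ (hit j))))

bump : List ℕ → List ℕ
bump []       = []
bump (d ∷ ds) = suc d ∷ ds

-- Moves the j-th letter (from 0) one tick earlier, leaving all others in place.
dent : ℕ → List ℕ → List ℕ
dent _       []       = []
dent zero    (d ∷ ds) = ℕ.pred d ∷ bump ds
dent (suc j) (d ∷ ds) = d ∷ dent j ds

length-bump : ∀ ds → length (bump ds) ≡ length ds
length-bump []       = refl
length-bump (d ∷ ds) = refl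

length-dent : ∀ j ds → length (dent j ds) ≡ length ds
length-dent _       []       = refl
length-dent zero    (d ∷ ds) = cong suc (length-bump ds)
length-dent (suc j) (d ∷ ds) = cong suc (length-dent j ds)

sum-bump : ∀ ds → sum (bump ds) ≤ suc (sum ds)
sum-bump []       = z≤n
sum-bump (d ∷ ds) = ℕₚ.≤-refl

sum-dent : ∀ j ds → sum (dent j ds) ≤ suc (sum ds)
sum-dent _       []       = z≤n
sum-dent zero    (d ∷ ds) = ℕₚ.≤-trans (ℕₚ.+-mono-≤ (ℕₚ.pred[n]≤n {d}) (sum-bump ds)) (ℕₚ.≤-reflexive (ℕₚ.+-suc d (sum ds)))
sum-dent (suc j) (d ∷ ds) = ℕₚ.≤-trans (ℕₚ.+-monoʳ-≤ d (sum-dent j ds)) (ℕₚ.≤-reflexive (ℕₚ.+-suc d (sum ds)))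

bump-positive : ∀ {ds} → All (0 <_) ds → All (0 <_) (bump ds)
bump-positive []       = []
bump-positive (_ ∷ 0<) = s≤s z≤n ∷ 0<

dent-positive : ∀ j n {c} → 1 < c → All (0 <_) (dent j (replicate n c))
dent-positive _       zero    1<c = []
dent-positive zero    (suc n) (s≤s 0<c) = 0<c ∷ bump-positive (all-replicate n (s≤s z≤n))
dent-positive (suc j) (suc n) 1<c = ℕₚ.<-trans (s≤s z≤n) 1<c ∷ dent-positive j n 1<c

-- A one-clock alternating automaton forbidding distance 1.

module NoUnitGap where

  exact : Constraint 1
  exact = (0F ≤ᶜ 1) ∧ᶜ (¬ᶜ (0F <ᶜ 1))

  -- The two guards are recognised by their syntax; a one-sided test is enough, since `δ₁` is
  -- undefined wherever it fails.
  exact? : ∀ σ → Maybe (σ ≡ exact)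
  exact? ((0F ≤ᶜ 1) ∧ᶜ (¬ᶜ (0F <ᶜ 1))) = just refl
  exact? _                             = nothing

  guard? : ∀ σ → Maybe (σ ≡ exact ⊎ σ ≡ ¬ᶜ exact)
  guard? (¬ᶜ σ) = Maybe.map (inj₂ ∘ cong ¬ᶜ_) (exact? σ)
  guard? σ      = Maybe.map inj₁ (exact? σ)

  pattern watching = 0F
  pattern timing   = 1F
  pattern failed   = 2F

  -- At each letter Adam may keep watching or start measuring from it with the clock reset; `failed`
  -- is a sink.
  next : Fin 3 → Bool → B⁺ (Fin 3 × Subset 1)
  next watching _     = atom (watching , ∅) ∧ atom (timing , ⁅ 0F ⁆)
  next timing   true  = atom (failed , ∅)
  next timing   false = atom (timing , ∅)
  next failed   _     = atom (failed , ∅)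

  δ₁ : Fin 3 → Fin 1 → Constraint 1 → Maybe (B⁺ (Fin 3 × Subset 1))
  δ₁ q a σ = Maybe.map (next q ∘ [ const true , const false ]′) (guard? σ)

  δ₁-inv : ∀ q a σ {b} → δ₁ q a σ ≡ just b → (σ ≡ exact × b ≡ next q true) ⊎ (σ ≡ ¬ᶜ exact × b ≡ next q false)
  δ₁-inv q a σ eq with guard? σ
  δ₁-inv q a σ refl | just (inj₁ σ≡) = inj₁ (σ≡ , refl)
  δ₁-inv q a σ refl | just (inj₂ σ≡) = inj₂ (σ≡ , refl)

  no-unit-gap : ATA 1 1
  no-unit-gap = record
    { locations = 3
    ; initial   = watching
    ; accepting = inside ∷ inside ∷ outside ∷ []
    ; δ         = δ₁
    ; finite    = λ q a → exact ∷ ¬ᶜ exact ∷ [] , λ {σ} (_ , eq) → listed (δ₁-inv q a σ eq)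
    ; disjoint  = λ q a v {σ} {σ′} (_ , eq) (_ , eq′) sat sat′ → disj (δ₁-inv q a σ eq) (δ₁-inv q a σ′ eq′) sat sat′
    -- Doubly negated excluded middle for `exact`: a refutation of `exact` is itself satisfaction of
    -- `¬ᶜ exact`.
    ; covering  = λ q a v none → none (¬ᶜ exact) (_ , refl) (none exact (_ , refl))
    }
    where
    listed : ∀ {σ} {P Q : Set} → (σ ≡ exact × P) ⊎ (σ ≡ ¬ᶜ exact × Q) → σ List.∈ exact ∷ ¬ᶜ exact ∷ []
    listed (inj₁ (refl , _)) = here refl
    listed (inj₂ (refl , _)) = there (here refl)
    disj : ∀ {v σ σ′} {P Q P′ Q′ : Set} → (σ ≡ exact × P) ⊎ (σ ≡ ¬ᶜ exact × Q) →
           (σ′ ≡ exact × P′) ⊎ (σ′ ≡ ¬ᶜ exact × Q′) → v ⊨ σ → v ⊨ σ′ → σ ≡ σ′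
    disj (inj₁ (refl , _)) (inj₁ (refl , _)) _    _    = refl
    disj (inj₂ (refl , _)) (inj₂ (refl , _)) _    _    = refl
    disj (inj₁ (refl , _)) (inj₂ (refl , _)) sat  ¬sat = ⊥-elim (¬sat sat)
    disj (inj₂ (refl , _)) (inj₁ (refl , _)) ¬sat sat  = ⊥-elim (¬sat sat)

  open ATA no-unit-gap

  module _ (k : ℕ) where
    open Floors k

    module _ (v : Valuation 1) {c} (v≈c : v 0F ≈ c) where

      exact⇒ : v ⊨ exact → c ≡ unit
      exact⇒ (v≤1 , v≮1) = ℕₚ.≤-antisym (subst (c ≤_) (ℕₚ.+-identityʳ unit) (≤-≈⇒ v≈c 1 v≤1))
        (ℕₚ.≮⇒≥ (v≮1 ∘ <-≈⇐ v≈c 1 ∘ subst (c <_) (sym (ℕₚ.+-identityʳ unit))))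

      exact⇐ : c ≡ unit → v ⊨ exact
      exact⇐ refl = ≤-≈⇐ v≈c 1 (ℕₚ.≤-reflexive (sym (ℕₚ.+-identityʳ unit))) ,
        λ v<1 → ℕₚ.<-irrefl (sym (ℕₚ.+-identityʳ unit)) (<-≈⇒ v≈c 1 v<1)

    -- A clock starting at c never equals 1 when a letter is read.
    data Clean : ℕ → List ℕ → Set where
      []  : ∀ {c} → Clean c []
      _∷_ : ∀ {c d ds} → c + d ≢ unit → Clean (c + d) ds → Clean c (d ∷ ds)

    data AllClean : List ℕ → Set where
      []  : AllClean []
      _∷_ : ∀ {d ds} → Clean 0 ds → AllClean ds → AllClean (d ∷ ds)

    timing-safe : ∀ {s q c ds} v → v 0F ≈ c → Clean c ds → Play s (between timing v (word ds)) q → q ∈ accepting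
    timing-safe v v≈c []            finish = there here
    timing-safe v v≈c (c≢u ∷ clean) (phase {σ = σ} δ≡b sat p) with δ₁-inv timing zero σ δ≡b
    ... | inj₁ (refl , refl) = contradiction (exact⇒ (v ⊕ delay _) (+-≈ v≈c _) sat) c≢u
    timing-safe v v≈c (c≢u ∷ clean) (phase δ≡b sat (move p)) | inj₂ (refl , refl) = timing-safe _ (+-≈ v≈c _) clean p

    watching-safe : ∀ {s q ds} v → AllClean ds → Play s (between watching v (word ds)) q → q ∈ accepting
    watching-safe v []              finish = here
    watching-safe v (clean ∷ allcl) (phase {σ = σ} δ≡b sat p) with [ proj₂ , proj₂ ]′ (δ₁-inv watching zero σ δ≡b)
    watching-safe v (clean ∷ allcl) (phase δ≡b sat (adam left (move p)))  | refl = watching-safe _ allcl p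
    watching-safe v (clean ∷ allcl) (phase δ≡b sat (adam right (move p))) | refl = timing-safe _ 0₊≈0 clean p

    -- `Hits` and `Doomed` are the witnessed opposites of `Clean` and `AllClean`; they tell Adam
    -- from which letter to measure.
    data Hits : ℕ → List ℕ → Set where
      here  : ∀ {c d ds} → c + d ≡ unit → Hits c (d ∷ ds)
      there : ∀ {c d ds} → Hits (c + d) ds → Hits c (d ∷ ds)

    data Doomed : List ℕ → Set where
      start : ∀ {d ds} → Hits 0 ds → Doomed (d ∷ ds)
      later : ∀ {d ds} → Doomed ds → Doomed (d ∷ ds)

    turn : ∀ {s q q′ v c d w} → v 0F ≈ c →
           (c + d ≡ unit → Play s (within (next q true) (v ⊕ delay d) w) q′) →
           (c + d ≢ unit → Play s (within (next q false) (v ⊕ delay d) w) q′) →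
           Play s (between q v ((zero , delay d) ∷ w)) q′
    turn {v = v} {c} {d} v≈c on off with c + d ℕₚ.≟ unit
    ... | yes c≡u = phase {σ = exact} refl (exact⇐ (v ⊕ delay d) (+-≈ v≈c d) c≡u) (on c≡u)
    ... | no  c≢u = phase {σ = ¬ᶜ exact} refl (c≢u ∘ exact⇒ (v ⊕ delay d) (+-≈ v≈c d)) (off c≢u)

    failed-play : ∀ {s c} ds v → v 0F ≈ c → Play s (between failed v (word ds)) failed
    failed-play []       v v≈c = finish
    failed-play (d ∷ ds) v v≈c = turn v≈c (λ _ → move (failed-play ds _ (+-≈ v≈c d))) (λ _ → move (failed-play ds _ (+-≈ v≈c d)))

    timing-play : ∀ {s c ds} v → v 0F ≈ c → Hits c ds → Play s (between timing v (word ds)) failed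
    timing-play {ds = d ∷ ds} v v≈c (here c≡u)   = turn v≈c (λ _ → move (failed-play ds _ (+-≈ v≈c d))) (contradiction c≡u)
    timing-play {ds = d ∷ ds} v v≈c (there hits) = turn v≈c (λ _ → move (failed-play ds _ (+-≈ v≈c d)))
                                                             (λ _ → move (timing-play _ (+-≈ v≈c d) hits))

    watching-play : ∀ {s c ds} v → v 0F ≈ c → Doomed ds → Play s (between watching v (word ds)) failed
    watching-play {ds = d ∷ ds} v v≈c (start hits) = turn v≈c (λ _ → play) (λ _ → play)
      where
      play : ∀ {s} → Play s (within (next watching true) (v ⊕ delay d) (word ds)) failed
      play = adam right (move (timing-play _ 0₊≈0 hits))
    watching-play {ds = d ∷ ds} v v≈c (later doom) = turn v≈c (λ _ → play) (λ _ → play)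
      where
      play : ∀ {s} → Play s (within (next watching true) (v ⊕ delay d) (word ds)) failed
      play = adam left (move (watching-play _ (+-≈ v≈c d) doom))

    -- The formulas contain no disjunction, so Eve never moves and any strategy serves.
    accepts-clean : ∀ {ds} → AllClean ds → Accepts (word ds)
    accepts-clean clean = (λ _ → left) , watching-safe v₀ clean

    rejects-doomed : ∀ {ds} → Doomed ds → ¬ Accepts (word ds)
    rejects-doomed doom (s , win) with there (there ()) ← win (watching-play v₀ 0₊≈0 doom)

-- Transfer of runs between words.

module Transfer {m} (B : NTA 1 m) (k : ℕ) where
  open Floors k
  open NTA B

  private
    variable
      q qf : Loc
      v v′ : Valuation m
      c c′ a g : Fin m → ℕ

  fits-head : ∀ {c d ds a} → Fits c (d ∷ ds) a → c + d HasFloor suc a / K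
  fits-head (fl ∷ _) = fl

  fits-tail : ∀ {c d ds a} → Fits c (d ∷ ds) a → Fits (c + d) ds (suc a)
  fits-tail (_ ∷ fits) = fits

  -- Common indices `a` give both words the same integer parts at every letter, hence the same
  -- guards hold. `Fresh` on both sides preserves this when resets return an index to 0.
  transfer : ∀ {ds ds′ : List ℕ} → length ds ≡ length ds′ → Fresh ds → Fresh ds′ →
             (∀ x → v x ≈ c x) → (∀ x → v′ x ≈ c′ x) → (∀ x → Fits (c x) ds (a x)) → (∀ x → Fits (c′ x) ds′ (a x)) →
             Run q v (word ds) qf → Run q v′ (word ds′) qf
  transfer {ds = []}    {[]}      _  _ _ _ _ _ _ stop = stop
  transfer {v = v} {c} {v′} {c′} {a} {ds = d ∷ ds} {d′ ∷ ds′} len (fit₀ ∷ fresh) (fit₀′ ∷ fresh′) v≈ v′≈ fits fits′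
    (step {σ = σ} {r = r} rule sat run) = step rule
      (⊩⇒⊨ (λ x → floor (+-≈ (v′≈ x) d′) (fits-head (fits′ x))) σ
        (⊨⇒⊩ (λ x → floor (+-≈ (v≈ x) d) (fits-head (fits x))) σ sat))
      (transfer {a = λ x → if does (x ∈? r) then 0 else suc (a x)} (ℕₚ.suc-injective len) fresh fresh′
        (λ x → reset-≈ (v ⊕ delay d) r x (+-≈ (v≈ x) d))
        (λ x → reset-≈ (v′ ⊕ delay d′) r x (+-≈ (v′≈ x) d′))
        (λ x → reset-fits r x fit₀ (fits-tail (fits x)))
        (λ x → reset-fits r x fit₀′ (fits-tail (fits′ x)))
        run)

  -- The situation after n letters of a run from (q , v); grid x is the number of
  -- letters since the last reset of x.
  record Reached (q : Loc) (v : Valuation m) (n : ℕ) (ds : List ℕ) (qf : Loc) (bound : ℕ) : Set where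
    field
      {loc}  : Loc
      {val}  : Valuation m
      grid   : Fin m → ℕ
      grid≤  : ∀ x → grid x ≤ bound
      val≈   : ∀ x → val x ≈ 4 * grid x
      rest   : Run loc val (word ds) qf
      resume : ∀ {ds′ : List ℕ} {q′} → Run loc val (word ds′) q′ → Run q v (word (replicate n 4 ++ ds′)) q′

  reach : ∀ n {ds bound} → (∀ x → v x ≈ 4 * g x) → (∀ x → g x + n ≤ bound) →
          Run q v (word (replicate n 4 ++ ds)) qf → Reached q v n ds qf bound
  reach {g = g} zero v≈ g≤ run = record
    { grid = g ; grid≤ = λ x → ℕₚ.m+n≤o⇒m≤o (g x) (g≤ x) ; val≈ = v≈ ; rest = run ; resume = λ run → run }
  reach {v = v} {g = g} (suc n) {bound = bound} v≈ g≤ (step {r = r} rule sat run) = record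
    { grid   = grid tail-reached
    ; grid≤  = grid≤ tail-reached
    ; val≈   = val≈ tail-reached
    ; rest   = rest tail-reached
    ; resume = λ run → step rule sat (resume tail-reached run)
    }
    where
    open Reached
    g′ : Fin m → ℕ
    g′ x = if does (x ∈? r) then 0 else suc (g x)
    next≈ : ∀ x → ((v ⊕ delay 4) [ r :=0]) x ≈ 4 * g′ x
    next≈ x with does (x ∈? r)
    ... | true  = 0₊≈0
    ... | false = subst (v x +₊ delay 4 ≈_) (4*n+4≡4*[1+n] (g x)) (+-≈ (v≈ x) 4)
    next≤ : ∀ x → g′ x + n ≤ bound
    next≤ x with does (x ∈? r)
    ... | true  = ℕₚ.≤-trans (ℕₚ.≤-trans (ℕₚ.n≤1+n n) (ℕₚ.m≤n+m (suc n) (g x))) (g≤ x)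
    ... | false = subst (_≤ bound) (ℕₚ.+-suc (g x) n) (g≤ x)
    tail-reached = reach n {bound = bound} next≈ next≤ run

-- Words with two halves about one time unit apart.

module Words (m : ℕ) where

  N : ℕ
  N = suc m

  open Floors N
  open NoUnitGap using (Hits; here; there; Doomed; start; later; Clean; []; _∷_; AllClean)

  -- After N letters with delay 4, the letters of base come one time unit and one
  -- tick after them, since unit = 4(N + 1).
  base : List ℕ
  base = 9 ∷ replicate m 4

  perturbed : ℕ → List ℕ
  perturbed j = replicate N 4 ++ dent j base

  slot-start : ∀ g → 4 * g + 9 ≡ 4 * suc (suc g) + 1
  slot-start = solve-∀

  fits-base : ∀ g → Fits (4 * g) base (suc g)
  fits-base g = subst (_HasFloor suc (suc g) / K) (sym (slot-start g)) (slot-floor (suc (suc g)) 0 (s≤s z≤n))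
              ∷ slots-fit m (suc (suc g)) 0 (s≤s z≤n) (slot-start g)

  -- Letters other than the dented one fall one tick past a multiple of 4, where `slot-floor`
  -- applies. The dented letter falls on a multiple of 4, so its integer part is assumed; the next
  -- delay, 5 instead of 4, restores the offset.
  fits-dent : ∀ j n {d c a} → c + suc d ≡ 4 * suc a + 1 → 4 * (suc a + j) HasFloor (suc a + j) / K →
              Fits c (dent j (suc d ∷ replicate n 4)) a
  fits-dent zero n {d} {c} {a} eq fl =
    subst₂ (λ t s → t HasFloor s / K)
      (trans (cong (4 *_) (ℕₚ.+-identityʳ (suc a))) (sym eq′)) (ℕₚ.+-identityʳ (suc a)) fl ∷ bumped n
    where
    eq′ : c + d ≡ 4 * suc a
    eq′ = ℕₚ.suc-injective (trans (sym (ℕₚ.+-suc c d)) (trans eq (ℕₚ.+-comm (4 * suc a) 1)))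
    shift : ∀ a → 4 * a + 5 ≡ 4 * suc a + 1
    shift = solve-∀
    eq″ : c + d + 5 ≡ 4 * suc (suc a) + 1
    eq″ = trans (cong (_+ 5) eq′) (shift (suc a))
    bumped : ∀ n → Fits (c + d) (bump (replicate n 4)) (suc a)
    bumped zero    = []
    bumped (suc n) = subst (_HasFloor suc (suc a) / K) (sym eq″) (slot-floor (suc (suc a)) 0 (s≤s z≤n))
                   ∷ slots-fit n (suc (suc a)) 0 (s≤s z≤n) eq″
  fits-dent (suc j) n {d} {c} {a} eq fl =
    subst (_HasFloor suc a / K) (sym eq) (slot-floor (suc a) 0 (s≤s z≤n)) ∷ rest n
    where
    shift : ∀ a → 4 * a + 1 + 4 ≡ 4 * suc a + 1
    shift = solve-∀
    rest : ∀ n → Fits (c + suc d) (dent j (replicate n 4)) (suc a)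
    rest zero    = []
    rest (suc n) = fits-dent j n (trans (cong (_+ 4) eq) (shift (suc a)))
      (subst (λ s → 4 * s HasFloor s / K) (ℕₚ.+-suc (suc a) j) fl)

  4m<unit : suc (4 * m) < unit
  4m<unit = ℕₚ.≤-trans (ℕₚ.+-monoˡ-≤ (4 * m) {2} {8} (s≤s (s≤s z≤n))) (ℕₚ.≤-reflexive (eight m))
    where
    eight : ∀ m → 8 + 4 * m ≡ 4 * suc (suc m)
    eight = solve-∀

  sum-fours : sum (replicate m 4) ≡ 4 * m
  sum-fours = trans (sum-replicate m 4) (ℕₚ.*-comm m 4)

  m<K : m < K
  m<K = ℕₚ.n≤1+n (suc m)

  fresh-base : Fresh base
  fresh-base = short-fresh (all-replicate m (s≤s z≤n))
    (subst (_< unit) (sym sum-fours) (ℕₚ.<-trans (ℕₚ.n<1+n (4 * m)) 4m<unit))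
    (subst (_< K) (sym (Listₚ.length-replicate m)) m<K)

  -- After a reset in the second half at most `4 * m + 1` ticks remain, the dent adding no more than
  -- one; this is below a unit.
  fresh-dent : ∀ j → Fresh (dent j base)
  fresh-dent zero = short-fresh (bump-positive (all-replicate m (s≤s z≤n)))
    (ℕₚ.≤-<-trans (sum-bump (replicate m 4)) (subst (λ s → suc s < unit) (sym sum-fours) 4m<unit))
    (subst (_< K) (sym (trans (length-bump (replicate m 4)) (Listₚ.length-replicate m))) m<K)
  fresh-dent (suc j) = short-fresh (dent-positive j m (s≤s (s≤s z≤n)))
    (ℕₚ.≤-<-trans (sum-dent j (replicate m 4)) (subst (λ s → suc s < unit) (sym sum-fours) 4m<unit))
    (subst (_< K) (sym (trans (length-dent j (replicate m 4)) (Listₚ.length-replicate m))) m<K)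

  on-grid-floor : ∀ a → 0 < a → a < 2 * K → a ≢ K → 4 * a HasFloor a / K
  on-grid-floor (suc a) _ a<2K a≢K with ℕₚ.<-cmp (suc a) K
  ... | tri≈ _ a≡K _ = contradiction a≡K a≢K
  ... | tri< a<K _ _ = subst (4 * suc a HasFloor_) (sym (m<n⇒m/n≡0 a<K))
    (s≤s z≤n , subst (4 * suc a <_) (sym (ℕₚ.+-identityʳ unit)) (ℕₚ.*-monoʳ-< 4 a<K))
  ... | tri> _ _ K<a = subst (4 * suc a HasFloor_) (sym a/K≡1)
    (subst (_< 4 * suc a) (sym (ℕₚ.+-identityʳ unit)) (ℕₚ.*-monoʳ-< 4 K<a) ,
     subst (4 * suc a <_) (double K) (ℕₚ.*-monoʳ-< 4 a<2K))
    where
    double : ∀ n → 4 * (2 * n) ≡ 2 * (4 * n)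
    double = solve-∀
    a/K≡1 : suc a / K ≡ 1
    a/K≡1 = ℕₚ.≤-antisym (ℕₚ.≤-pred (m<n*o⇒m/o<n {n = 2} {o = K} a<2K)) (m≥n⇒m/n>0 (ℕₚ.<⇒≤ K<a))

  -- The dented letter finds the clock at `4 * (g + 2 + j)` ticks, between 0 and two units. The only
  -- integer there is `unit = 4 * (m + 2)`, reached when `j + g` is `m`.
  fits-perturbed : ∀ {j g} → j ≤ m → g ≤ N → j + g ≢ m → Fits (4 * g) (dent j base) (suc g)
  fits-perturbed {j} {g} j≤m g≤N j+g≢m = fits-dent j m (slot-start g)
    (on-grid-floor (suc (suc g) + j) (s≤s z≤n) bound
      (λ eq → j+g≢m (trans (ℕₚ.+-comm j g) (ℕₚ.suc-injective (ℕₚ.suc-injective eq)))))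
    where
    total : ∀ m → suc (suc (suc (suc m) + m)) ≡ 2 * suc (suc m)
    total = solve-∀
    bound : suc (suc g) + j < 2 * K
    bound = ℕₚ.≤-trans (s≤s (s≤s (s≤s (ℕₚ.+-mono-≤ g≤N j≤m)))) (ℕₚ.≤-reflexive (total m))

  hits-skip : ∀ n {g ds} → Hits N (4 * (g + n)) ds → Hits N (4 * g) (replicate n 4 ++ ds)
  hits-skip zero    {g} {ds} hits = subst (λ g → Hits N (4 * g) ds) (ℕₚ.+-identityʳ g) hits
  hits-skip (suc n) {g} {ds} hits = there (subst (λ c → Hits N c (replicate n 4 ++ ds)) (sym (4*n+4≡4*[1+n] g))
    (hits-skip n {suc g} (subst (λ g → Hits N (4 * g) ds) (ℕₚ.+-suc g n) hits)))

  hits-dent : ∀ j n {c d} → j ≤ n → c + (d + 4 * j) ≡ unit → Hits N c (dent j (suc d ∷ replicate n 4))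
  hits-dent zero    n       {c} {d} _         eq = here (trans (cong (c +_) (sym (ℕₚ.+-identityʳ d))) eq)
  hits-dent (suc j) (suc n) {c} {d} (s≤s j≤n) eq = there (hits-dent j n j≤n (trans (shift c d j) eq))
    where
    shift : ∀ c d j → c + suc d + (3 + 4 * j) ≡ c + (d + 4 * suc j)
    shift = solve-∀

  doomed-after : ∀ n {ds} → Hits N 0 ds → Doomed N (replicate (suc n) 4 ++ ds)
  doomed-after zero    hits = start hits
  doomed-after (suc n) hits = later (doomed-after n hits)

  -- Letter `j` of the first half is followed by `g` more letters there, `4 * g` ticks in all; the
  -- dented letter comes `8 + 4 * j` ticks later, which completes `unit`.
  doomed : ∀ j g → j + g ≡ m → Doomed N (perturbed j)
  doomed j g refl = subst (Doomed N) (sym (replicate-++ (suc j) g (dent j base)))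
    (doomed-after j (hits-skip g {0} (hits-dent j m (ℕₚ.m≤m+n j g) (total j g))))
    where
    total : ∀ j g → 4 * (0 + g) + (8 + 4 * j) ≡ 4 * suc (suc (j + g))
    total = solve-∀

  fits-clean : ∀ {c ds a} → Fits c ds a → Clean N c ds
  fits-clean []           = []
  fits-clean (fl ∷ fits) = not-unit fl ∷ fits-clean fits
    where
    not-unit : ∀ {c f} → c HasFloor f → c ≢ unit
    -- The value `unit` would have integer part below 1 and hence be less than itself.
    not-unit fl refl = ℕₚ.<-irrefl (sym (ℕₚ.+-identityʳ unit))
      (<-floor {b = 1} fl (floor-< {b = 1} fl (ℕₚ.m≤m+n unit 0)))

  clean-skip : ∀ n {a ds} → a + n < K → Clean N (4 * (a + n)) ds → Clean N (4 * a) (replicate n 4 ++ ds)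
  clean-skip zero    {a} {ds} _   clean = subst (λ a → Clean N (4 * a) ds) (ℕₚ.+-identityʳ a) clean
  clean-skip (suc n) {a} {ds} a<K clean =
    (λ eq → ℕₚ.<⇒≢ (ℕₚ.≤-<-trans (ℕₚ.m≤m+n (suc a) n) a<K′)
      (ℕₚ.*-cancelˡ-≡ (suc a) K 4 (trans (sym (4*n+4≡4*[1+n] a)) eq)))
    ∷ subst (λ c → Clean N c (replicate n 4 ++ ds)) (sym (4*n+4≡4*[1+n] a))
        (clean-skip n {suc a} a<K′ (subst (λ a → Clean N (4 * a) ds) (ℕₚ.+-suc a n) clean))
    where
    a<K′ : suc a + n < K
    a<K′ = subst (_< K) (ℕₚ.+-suc a n) a<K

  fresh-all-clean : ∀ {ds} → Fresh ds → AllClean N ds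
  fresh-all-clean []            = []
  fresh-all-clean (fit ∷ fresh) = fits-clean fit ∷ fresh-all-clean fresh

  all-clean : ∀ n → n ≤ N → AllClean N (replicate n 4 ++ base)
  all-clean zero    _   = fresh-all-clean fresh-base
  all-clean (suc n) n<N = clean-skip n {0} (ℕₚ.<-trans n<N (ℕₚ.n<1+n N)) (fits-clean (fits-base n)) ∷ all-clean n (ℕₚ.<⇒≤ n<N)

-- Fooling an automaton with `m` clocks.

module _ {m} (B : NTA 1 m) where
  open Words m
  open Floors N
  open Transfer B N
  open NTA B

  no-unit-gap-not-nta : ¬ (∀ {w} → (ATA.Accepts NoUnitGap.no-unit-gap w → Accepts w) ×
                                   (Accepts w → ATA.Accepts NoUnitGap.no-unit-gap w))
  no-unit-gap-not-nta same =
    let q , run , q∈F     = proj₁ same (NoUnitGap.accepts-clean N (all-clean N ℕₚ.≤-refl))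
        reached           = reach {g = λ _ → 0} N (λ _ → 0₊≈0) (λ _ → ℕₚ.≤-refl) run
        open Reached reached
        -- A clock last reset at letter `j`, counted from 0, has seen `m - j` further letters of the
        -- first half; so no clock dates from letter `m - g`.
        g , g≤m , g-free  = missed-value grid
        j                 = m ℕ.∸ g
        j+g≡m             = ℕₚ.m∸n+n≡m g≤m
        -- The first half of the run is kept; only its continuation from `val` is moved to the
        -- dented letters.
        run′              = resume (transfer {a = suc ∘ grid} (sym (length-dent j base)) fresh-base (fresh-dent j) val≈ val≈
                              (λ x → fits-base (grid x))
                              (λ x → fits-perturbed (ℕₚ.m∸n≤m m g) (grid≤ x)
                                       (λ eq → g-free x (ℕₚ.+-cancelˡ-≡ j (grid x) g (trans eq (sym j+g≡m)))))
                              rest)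
    in NoUnitGap.rejects-doomed N (doomed j g j+g≡m) (proj₂ same (q , run′ , q∈F))

theorem1 : NTARecognizable ⊈ OneClockATARecognizable × OneClockATARecognizable ⊈ NTARecognizable
theorem1 = (λ ⊆ → let A , ⊆A , A⊆ = ⊆ {1 , NTA.Accepts Straddling.straddling} (2 , Straddling.straddling , id , id)
                  in Straddling.straddling-not-ata A (λ {w} → ⊆A {w} , A⊆ {w}))
         , (λ ⊆ → let _ , B , ⊆B , B⊆ = ⊆ {1 , ATA.Accepts NoUnitGap.no-unit-gap} (NoUnitGap.no-unit-gap , id , id)
                  in no-unit-gap-not-nta B (λ {w} → ⊆B {w} , B⊆ {w}))
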